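{- Let $M$ be a connected matroid, let $N$ be a binary matroid which is not a circuit (i.e., $E(N) \notin \mathcal{C}(N)$), and let $f: M \rightarrow N$ be a matroid homomorphism. Then there exist a matroid $H$, a matroid homeomorphism $g: M \rightarrow H$ and a circuit injection $h: H \rightarrow N$ such that $f = h \circ g$ (as maps of ground sets); moreover $M$ is isomorphic to a subdivision of $H = g(M)$.
   Context: For a matroid $X$, $E(X)$ denotes its ground set and $\mathcal{C}(X)$ its set of circuits. A matroid homomorphism $f: M \rightarrow N$ is a map $f: E(M) \rightarrow E(N)$ from the ground set of $M$ onto the ground set of $N$ such that $f(C) \in \mathcal{C}(N)$ for every $C \in \mathcal{C}(M)$. A homomorphism is a homeomorphism if in addition $f^{ -1}(D) \in \mathcal{C}(M)$ for every $D \in \mathcal{C}(N)$. A circuit injection is a homomorphism whose underlying map of ground sets is one-to-one. A matroid $M'$ is a series extension of a matroid $H'$ at an element $e \in E(H')$ by a new element $e'$ if $E(M') = E(H') \cup \{e'\}$ and $\mathcal{C}(M') = \{C : C \in \mathcal{C}(H'), e \notin C\} \cup \{C \cup \{e'\} : C \in \mathcal{C}(H'), e \in C\}$; a subdivision of $H'$ is any matroid obtained from $H'$ by a finite sequence (possibly empty) of series extensions. -}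

module Defs where

open import Data.Nat using (ℕ; suc)
open import Data.Fin using (Fin; zero; suc)
open import Data.Fin.Subset using (Subset; _∈_; _∉_; _⊆_; _⊂_; _∪_; _-_; ⊤; ⊥; Nonempty)
open import Data.Bool using (Bool; true; false; _∧_; _xor_; _∨_; if_then_else_)
open import Data.Vec using (Vec; []; _∷_; tabulate; lookup; foldr; zipWith; map)
open import Data.Product using (Σ; ∃; _×_; _,_)
open import Relation.Binary.PropositionalEquality using (_≡_; _≢_)
open import Relation.Nullary using (¬_)
open import Function.Definitions using (Injective; Surjective)

record Matroid (n : ℕ) : Set₁ where
  field
    Circuit    : Subset n → Set
    empty-not  : ¬ Circuit ⊥
    incomparable : ∀ {C D} → Circuit C → Circuit D → ¬ (C ⊂ D)
    elimination : ∀ {C D e} → Circuit C → Circuit D → C ≢ D →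
                  e ∈ C → e ∈ D → ∃ λ F → Circuit F × F ⊆ ((C ∪ D) - e)
open Matroid public

any : ∀ {n} → Vec Bool n → Bool
any = foldr _ _∨_ false

image : ∀ {m n} → (Fin m → Fin n) → Subset m → Subset n
image {m} f C = tabulate λ y → any (tabulate λ x → lookup C x ∧ eqFin (f x) y)
  where
  eqFin : ∀ {k} → Fin k → Fin k → Bool
  eqFin zero zero = true
  eqFin zero (suc _) = false
  eqFin (suc _) zero = false
  eqFin (suc a) (suc b) = eqFin a b

preimage : ∀ {m n} → (Fin m → Fin n) → Subset n → Subset m
preimage f D = tabulate λ x → lookup D (f x)

IsHom : ∀ {m n} → Matroid m → Matroid n → (Fin m → Fin n) → Set
IsHom {m} {n} M N f =
  Surjective _≡_ _≡_ f × (∀ C → Circuit M C → Circuit N (image f C))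

IsHomeo : ∀ {m n} → Matroid m → Matroid n → (Fin m → Fin n) → Set
IsHomeo M N f = IsHom M N f × (∀ D → Circuit N D → Circuit M (preimage f D))

IsCircuitInjection : ∀ {m n} → Matroid m → Matroid n → (Fin m → Fin n) → Set
IsCircuitInjection M N f = IsHom M N f × Injective _≡_ _≡_ f

Isomorphic : ∀ {m n} → Matroid m → Matroid n → Set
Isomorphic M N = ∃ λ φ → Injective _≡_ _≡_ φ × Surjective _≡_ _≡_ φ ×
  (∀ C → (Circuit M C → Circuit N (image φ C)) × (Circuit N (image φ C) → Circuit M C))

Connected : ∀ {n} → Matroid n → Set
Connected {n} M = ∀ (x y : Fin n) → x ≢ y → ∃ λ C → Circuit M C × x ∈ C × y ∈ C

-- Binary matroids: vector matroid of a GF(2)-matrix A (r rows, columns indexed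
-- by the ground set). A set of columns is linearly dependent over GF(2) iff
-- some nonempty subset of it sums to zero; circuits are minimal dependent sets.
ColumnSumZero : ∀ {r n} → (Fin r → Fin n → Bool) → Subset n → Set
ColumnSumZero A D = ∀ i → foldr _ _xor_ false (zipWith _∧_ D (tabulate (A i))) ≡ false

LinDependent : ∀ {r n} → (Fin r → Fin n → Bool) → Subset n → Set
LinDependent A C = ∃ λ D → D ⊆ C × Nonempty D × ColumnSumZero A D

MinimalDependent : ∀ {r n} → (Fin r → Fin n → Bool) → Subset n → Set
MinimalDependent A C = LinDependent A C × (∀ D → D ⊂ C → ¬ LinDependent A D)

Binary : ∀ {n} → Matroid n → Set
Binary {n} N = ∃ λ (r : ℕ) → ∃ λ (A : Fin r → Fin n → Bool) →
  ∀ C → (Circuit N C → MinimalDependent A C) × (MinimalDependent A C → Circuit N C)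

-- Series extension of H (on Fin k) at e by a new element; the new element is
-- zero : Fin (suc k) and old element x is suc x.  For C' = b ∷ C:
-- C' circuit ⇔ C circuit of H and (e' ∈ C' ⇔ e ∈ C), i.e. b ≡ C[e].
SeriesExtension : ∀ {k} → Matroid k → Fin k → Matroid (suc k) → Set
SeriesExtension H e M' = ∀ b C →
  (Circuit M' (b ∷ C) → Circuit H C × b ≡ lookup C e) ×
  (Circuit H C × b ≡ lookup C e → Circuit M' (b ∷ C))

data Subdivision {k} (H : Matroid k) : ∀ {j} → Matroid j → Set₁ where
  base : Subdivision H H
  step : ∀ {j} {S : Matroid j} {S' : Matroid (suc j)} (e : Fin j) →
         Subdivision H S → SeriesExtension S e S' → Subdivision H S'

{-# OPTIONS --safe #-}
-- The point is that two elements x, y with f x = f y lie in the same circuits of M; then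
-- identifying the elements of each fibre of f gives H, with g = f and h the identity, and M is
-- recovered from H by one series extension per collision.
--
-- Suppose some circuit contains x but not y.  Choose circuits C₁ ∋ x, y and C₂ containing exactly
-- one of x, y with C₁ ∪ C₂ minimal, and C₃ ⊆ C₁ ∪ C₂ containing only the other one.  Every
-- element of C₁ ∪ C₂ is then in at least two of the Cᵢ, so f C₁ + f C₂ + f C₃ (mod 2) is a
-- cycle of N which contains f x and lies in each f Cᵢ; hence f (C₁ ∪ C₂) is a single circuit D.
-- Now let U be connected with f U = D.  If a minimal ear of U contained p with f p ∉ D, the
-- images of any two circuits through p inside U and the ear would agree or be complementary on D,
-- and this forces every circuit of U to be all of U.  Since U contains two circuits, each ear is
-- mapped into D, and adding ears until U = E(M) makes E(N) = D a circuit.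
module Submission where

open import Defs
open import Algebra.Bundles using (CommutativeRing)
import Algebra.Properties.CommutativeSemigroup as CommutativeSemigroupProperties
open import Data.Bool using (Bool; true; false; _∧_; _xor_)
open import Data.Bool.Properties using (∨-zeroʳ; ∧-conicalˡ; ∧-conicalʳ; xor-∧-commutativeRing; ∧-distribʳ-xor)
import Data.Bool.Properties as Bool
open import Data.Empty using (⊥-elim) renaming (⊥ to Absurd)
open import Data.Fin using (Fin; zero; suc; punchIn; punchOut)
open import Data.Fin.Properties using (_≟_; any?; punchIn-punchOut; punchOut-punchIn; punchInᵢ≢i; punchOut-injective; punchOut-cong; suc-injective)
open import Data.Fin.Subset using (Subset; _∈_; _∉_; _⊆_; _⊂_; _∪_; _∩_; _-_; ∁; ∣_∣; ⊤; Nonempty; Empty)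
open import Data.Fin.Subset.Properties
open import Data.Nat using (ℕ; zero; suc; _<_)
open import Data.Nat.Induction using (<-wellFounded)
open import Data.Product using (Σ; ∃; _×_; _,_; proj₁; proj₂)
open import Data.Sum using (_⊎_; inj₁; inj₂; [_,_]′)
open import Data.Vec using ([]; _∷_; tabulate; lookup; foldr; zipWith)
open import Data.Vec.Properties using (lookup∘tabulate; lookup-zipWith; []=⇒lookup; lookup⇒[]=; ≡-dec; tabulate∘lookup)
open import Function using (_∘_; id)
open import Function.Definitions using (Injective; StrictlySurjective)
open import Function.Consequences.Propositional using (strictlySurjective⇒surjective)
open import Induction.WellFounded using (Acc; acc)
open import Relation.Binary.PropositionalEquality using (_≡_; _≢_; refl; sym; trans; cong; cong₂; subst)
open import Relation.Nullary using (¬_; yes; no; contradiction; ¬?; _×-dec_)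

-- Images, preimages and membership in subsets

private
  variable
    m n k : ℕ

mutual
  -- Unification against the unfolded `image` in `image-hit` solves the placeholder as the test of
  -- `f x` against `y`.
  hit : (Fin m → Fin n) → Subset m → Fin m → Fin n → Bool
  hit = _

  image-hit : (f : Fin m → Fin n) (C : Subset m) →
              image f C ≡ tabulate λ y → any (tabulate λ x → lookup C x ∧ hit f C x y)
  image-hit f C = refl

unless-zero : (Fin k → Bool) → Fin (suc k) → Bool
unless-zero φ zero    = false
unless-zero φ (suc a) = φ a

mutual
  -- The comparison of elements local to `image` has no name outside Defs, but unification
  -- recovers it.  Abstracting over `suc k` separates its index from the codomain of f,
  -- which makes it available for induction.
  same : (Fin m → Fin n) → Subset m → Fin k → Fin k → Bool
  same = _

  hit-suc : (f : Fin m → Fin (suc k)) (C : Subset m) (x : Fin m) (b : Fin k) →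
            hit f C x (suc b) ≡ unless-zero (λ a → same f C a b) (f x)
  hit-suc f C x b with f x
  hit-suc f C x b | zero = refl
  hit-suc {k = k} f C x b | suc a with suc k
  ... | _ = refl

same⇒≡ : (f : Fin m → Fin n) (C : Subset m) (a b : Fin k) → same f C a b ≡ true → a ≡ b
same⇒≡ f C zero    zero    _ = refl
same⇒≡ f C (suc a) (suc b) p = cong suc (same⇒≡ f C a b p)

same-refl : (f : Fin m → Fin n) (C : Subset m) (a : Fin k) → same f C a a ≡ true
same-refl f C zero    = refl
same-refl f C (suc a) = same-refl f C a

any-tabulate⁺ : (φ : Fin n → Bool) (x : Fin n) → φ x ≡ true → any (tabulate φ) ≡ true
any-tabulate⁺ φ zero    p rewrite p = refl
any-tabulate⁺ φ (suc x) p rewrite any-tabulate⁺ (φ ∘ suc) x p = ∨-zeroʳ (φ zero)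

any-tabulate⁻ : (φ : Fin n → Bool) → any (tabulate φ) ≡ true → ∃ λ x → φ x ≡ true
any-tabulate⁻ {suc n} φ p with φ zero in eq
... | true  = zero , eq
... | false = let x , q = any-tabulate⁻ (φ ∘ suc) p in suc x , q

∈-image⁺ : (f : Fin m → Fin n) {C : Subset m} {x : Fin m} → x ∈ C → f x ∈ image f C
∈-image⁺ f {C} {x} x∈C = lookup⇒[]= (f x) (image f C)
  (trans (lookup∘tabulate _ (f x))
    (any-tabulate⁺ _ x (cong₂ _∧_ ([]=⇒lookup x∈C) (same-refl f C (f x)))))

∈-image⁻ : (f : Fin m → Fin n) {C : Subset m} {y : Fin n} →
           y ∈ image f C → ∃ λ x → x ∈ C × f x ≡ y
∈-image⁻ f {C} {y} y∈fC =
  let x , p = any-tabulate⁻ _ (trans (sym (lookup∘tabulate _ y)) ([]=⇒lookup y∈fC))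
  in x , lookup⇒[]= x C (∧-conicalˡ (lookup C x) _ p)
       , same⇒≡ f C (f x) y (∧-conicalʳ (lookup C x) _ p)

∈-preimage⁺ : (f : Fin m → Fin n) {D : Subset n} {x : Fin m} → f x ∈ D → x ∈ preimage f D
∈-preimage⁺ f {D} {x} fx∈D = lookup⇒[]= x (preimage f D) (trans (lookup∘tabulate _ x) ([]=⇒lookup fx∈D))

∈-preimage⁻ : (f : Fin m → Fin n) {D : Subset n} {x : Fin m} → x ∈ preimage f D → f x ∈ D
∈-preimage⁻ f {D} {x} x∈ = lookup⇒[]= (f x) D (trans (sym (lookup∘tabulate _ x)) ([]=⇒lookup x∈))

∉-minus : (p : Subset n) (x : Fin n) → x ∉ p - x
∉-minus (_ ∷ p) zero    ()
∉-minus (_ ∷ p) (suc x) q = ∉-minus p x (drop-there q)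

⊆-minus : {p q : Subset n} {x : Fin n} → p ⊆ q → x ∉ p → p ⊆ q - x
⊆-minus p⊆q x∉p z∈p = x∈p∧x≢y⇒x∈p-y (p⊆q z∈p) λ { refl → x∉p z∈p }

∪-⊆ : {p q r : Subset n} → p ⊆ r → q ⊆ r → p ∪ q ⊆ r
∪-⊆ {p = p} {q} p⊆r q⊆r z∈ with x∈p∪q⁻ p q z∈
... | inj₁ z∈p = p⊆r z∈p
... | inj₂ z∈q = q⊆r z∈q

-- Symmetric difference of subsets

infixr 6 _⊕_

_⊕_ : Subset n → Subset n → Subset n
_⊕_ = zipWith _xor_

lookup-⊕ : (S T : Subset n) {x : Fin n} {b c : Bool} →
           lookup S x ≡ b → lookup T x ≡ c → lookup (S ⊕ T) x ≡ b xor c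
lookup-⊕ S T {x} p q = trans (lookup-zipWith _xor_ x S T) (cong₂ _xor_ p q)

∉⇒lookup≡false : (S : Subset n) {x : Fin n} → x ∉ S → lookup S x ≡ false
∉⇒lookup≡false S {x} x∉S with lookup S x in eq
... | true  = contradiction (lookup⇒[]= x S eq) x∉S
... | false = refl

∈-⊕⁺ˡ : {S T : Subset n} {x : Fin n} → x ∈ S → x ∉ T → x ∈ S ⊕ T
∈-⊕⁺ˡ {S = S} {T} x∈S x∉T =
  lookup⇒[]= _ (S ⊕ T) (lookup-⊕ S T ([]=⇒lookup x∈S) (∉⇒lookup≡false T x∉T))

∈-⊕⁺ʳ : {S T : Subset n} {x : Fin n} → x ∉ S → x ∈ T → x ∈ S ⊕ T
∈-⊕⁺ʳ {S = S} {T} x∉S x∈T =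
  lookup⇒[]= _ (S ⊕ T) (lookup-⊕ S T (∉⇒lookup≡false S x∉S) ([]=⇒lookup x∈T))

∉-⊕ : {S T : Subset n} {x : Fin n} → x ∈ S → x ∈ T → x ∉ S ⊕ T
∉-⊕ {S = S} {T} x∈S x∈T x∈S⊕T
  with () ← trans (sym ([]=⇒lookup x∈S⊕T)) (lookup-⊕ S T ([]=⇒lookup x∈S) ([]=⇒lookup x∈T))

∈-⊕⁻ : (S T : Subset n) {x : Fin n} → x ∈ S ⊕ T → (x ∈ S × x ∉ T) ⊎ (x ∉ S × x ∈ T)
∈-⊕⁻ S T {x} x∈S⊕T with x ∈? S | x ∈? T
... | yes x∈S | yes x∈T = contradiction x∈S⊕T (∉-⊕ x∈S x∈T)
... | yes x∈S | no  x∉T = inj₁ (x∈S , x∉T)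
... | no  x∉S | yes x∈T = inj₂ (x∉S , x∈T)
... | no  x∉S | no  x∉T
  with () ← trans (sym ([]=⇒lookup x∈S⊕T)) (lookup-⊕ S T (∉⇒lookup≡false S x∉S) (∉⇒lookup≡false T x∉T))

-- Circuit elimination

module Circuits (M : Matroid n) where

  circuit-⊆⇒⊇ : ∀ {C D} → Circuit M C → Circuit M D → C ⊆ D → D ⊆ C
  circuit-⊆⇒⊇ {C} c d C⊆D {x} x∈D with x ∈? C
  ... | yes x∈C = x∈C
  ... | no  x∉C = contradiction ((λ {_} → C⊆D) , x , x∈D , x∉C) (incomparable M c d)

  circuit-∖-nonempty : ∀ {C D e} → Circuit M C → Circuit M D → e ∈ D → e ∉ C →
                       ∃ λ h → h ∈ C × h ∉ D
  circuit-∖-nonempty {C} {D} c d e∈D e∉C with any? (λ h → h ∈? C ×-dec ¬? (h ∈? D))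
  ... | yes w = w
  ... | no ¬w = contradiction (circuit-⊆⇒⊇ c d C⊆D e∈D) e∉C
    where
    C⊆D : C ⊆ D
    C⊆D {x} x∈C with x ∈? D
    ... | yes x∈D = x∈D
    ... | no  x∉D = contradiction (x , x∈C , x∉D) ¬w

  circuit-nonempty : ∀ {C} → Circuit M C → Nonempty C
  circuit-nonempty {C} c with nonempty? C
  ... | yes ne = ne
  ... | no  em = contradiction (subst (Circuit M) (Empty-unique em) c) (empty-not M)

  eliminate : ∀ {C D e} → Circuit M C → Circuit M D → C ≢ D → e ∈ C → e ∈ D →
              ∃ λ F → Circuit M F × F ⊆ C ∪ D × e ∉ F
  eliminate {C} {D} {e} c d C≢D e∈C e∈D =
    let F , cF , F⊆ = elimination M c d C≢D e∈C e∈D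
    in F , cF , (λ z∈F → p─q⊆p (C ∪ D) _ (F⊆ z∈F)) , λ e∈F → ∉-minus (C ∪ D) e (F⊆ e∈F)

  -- Induction on the size of a set `V` containing both circuits. If weak elimination yields `F`
  -- without `g`, some `h ∈ F` lies in `D` but not in `C`. Eliminating `h` from `D` and `F` while
  -- keeping `e` takes place inside `V - g`; eliminating `e` from `C` and the resulting `G` while
  -- keeping `g` takes place inside `V - h`.
  strong-elimination-within :
    ∀ {C D e g} (V : Subset n) → Acc _<_ ∣ V ∣ → C ⊆ V → D ⊆ V →
    Circuit M C → Circuit M D → e ∈ C → e ∈ D → g ∈ C → g ∉ D →
    ∃ λ F → Circuit M F × F ⊆ C ∪ D × e ∉ F × g ∈ F
  strong-elimination-within {C} {D} {e} {g} V (acc rec) C⊆V D⊆V c d e∈C e∈D g∈C g∉D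
    with F , cF , F⊆ , e∉F ← eliminate c d (λ { refl → g∉D g∈C }) e∈C e∈D
    with g ∈? F
  ... | yes g∈F = F , cF , (λ {_} → F⊆) , e∉F , g∈F
  ... | no  g∉F
    with h , h∈F , h∉C ← circuit-∖-nonempty cF c e∈C e∉F
    with h∈D ← [ (λ h∈C → contradiction h∈C h∉C) , id ]′ (x∈p∪q⁻ C D (F⊆ h∈F))
    with G , cG , G⊆ , h∉G , e∈G ← strong-elimination-within (V - g) (rec (x∈p⇒∣p-x∣<∣p∣ (C⊆V g∈C)))
           (⊆-minus D⊆V g∉D) (⊆-minus (∪-⊆ C⊆V D⊆V ∘ F⊆) g∉F) d cF h∈D h∈F e∈D e∉F
    with G⊆V ← (λ {z} (z∈G : z ∈ G) → ∪-⊆ D⊆V (∪-⊆ C⊆V D⊆V ∘ F⊆) (G⊆ z∈G))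
    with K , cK , K⊆ , e∉K , g∈K ← strong-elimination-within (V - h) (rec (x∈p⇒∣p-x∣<∣p∣ (D⊆V h∈D)))
           (⊆-minus C⊆V h∉C) (⊆-minus G⊆V h∉G) c cG e∈C e∈G g∈C
           (λ g∈G → [ g∉D , g∉F ]′ (x∈p∪q⁻ D F (G⊆ g∈G)))
    = K , cK , (λ z∈K → ∪-⊆ (p⊆p∪q D) (∪-⊆ (q⊆p∪q C D) F⊆ ∘ G⊆) (K⊆ z∈K)) , e∉K , g∈K

  strong-elimination : ∀ {C D e g} → Circuit M C → Circuit M D →
                       e ∈ C → e ∈ D → g ∈ C → g ∉ D →
                       ∃ λ F → Circuit M F × F ⊆ C ∪ D × e ∉ F × g ∈ F
  strong-elimination {C} {D} =
    strong-elimination-within (C ∪ D) (<-wellFounded _) (p⊆p∪q D) (q⊆p∪q C D)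

  -- Transitivity of lying on a common circuit. Eliminating `c` gives `F` through `p` and `G`
  -- through `a`. If `F` misses some `t` of `C` outside `D`, then `F` and `D` meet and lie in
  -- `V - t`. Otherwise `F` contains all of `C` outside `D`, hence meets `G`, and both lie in
  -- `V - c`.
  common-circuit-within :
    ∀ {C D p c a} (V : Subset n) → Acc _<_ ∣ V ∣ → C ⊆ V → D ⊆ V →
    Circuit M C → Circuit M D → p ∈ C → c ∈ C → c ∈ D → a ∈ D →
    ∃ λ F → Circuit M F × F ⊆ V × p ∈ F × a ∈ F
  common-circuit-within {C} {D} {p} {c} {a} V (acc rec) C⊆V D⊆V cC cD p∈C c∈C c∈D a∈D
    with p ∈? D | a ∈? C
  ... | yes p∈D | _       = D , cD , (λ {_} → D⊆V) , p∈D , a∈D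
  ... | no  _   | yes a∈C = C , cC , (λ {_} → C⊆V) , p∈C , a∈C
  ... | no  p∉D | no  a∉C
    with F , cF , F⊆ , c∉F , p∈F ← strong-elimination cC cD c∈C c∈D p∈C p∉D
    with G , cG , G⊆ , c∉G , a∈G ← strong-elimination cD cC c∈D c∈C a∈D a∉C
    with F⊆V ← (λ {z} (z∈F : z ∈ F) → ∪-⊆ C⊆V D⊆V (F⊆ z∈F))
    with any? (λ t → t ∈? C ×-dec ¬? (t ∈? D) ×-dec ¬? (t ∈? F))
  ... | yes (t , t∈C , t∉D , t∉F) =
    let h , h∈F , h∉C = circuit-∖-nonempty cF cC c∈C c∉F
        h∈D = [ (λ h∈C → contradiction h∈C h∉C) , id ]′ (x∈p∪q⁻ C D (F⊆ h∈F))
        K , cK , K⊆ , p∈K , a∈K = common-circuit-within (V - t) (rec (x∈p⇒∣p-x∣<∣p∣ (C⊆V t∈C)))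
          (⊆-minus F⊆V t∉F) (⊆-minus D⊆V t∉D) cF cD p∈F h∈F h∈D a∈D
    in K , cK , (λ z∈K → p─q⊆p V _ (K⊆ z∈K)) , p∈K , a∈K
  ... | no ¬t =
    let h , h∈G , h∉D = circuit-∖-nonempty cG cD c∈D c∉G
        h∈C = [ (λ h∈D → contradiction h∈D h∉D) , id ]′ (x∈p∪q⁻ D C (G⊆ h∈G))
        K , cK , K⊆ , p∈K , a∈K = common-circuit-within (V - c) (rec (x∈p⇒∣p-x∣<∣p∣ (C⊆V c∈C)))
          (⊆-minus F⊆V c∉F) (⊆-minus (∪-⊆ D⊆V C⊆V ∘ G⊆) c∉G) cF cG p∈F (C∖D⊆F h∈C h∉D) h∈G a∈G
    in K , cK , (λ z∈K → p─q⊆p V _ (K⊆ z∈K)) , p∈K , a∈K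
    where
    C∖D⊆F : ∀ {t} → t ∈ C → t ∉ D → t ∈ F
    C∖D⊆F {t} t∈C t∉D with t ∈? F
    ... | yes t∈F = t∈F
    ... | no  t∉F = contradiction (t , t∈C , t∉D , t∉F) ¬t

  common-circuit : ∀ {C D p c a V} → C ⊆ V → D ⊆ V → Circuit M C → Circuit M D →
                   p ∈ C → c ∈ C → c ∈ D → a ∈ D →
                   ∃ λ F → Circuit M F × F ⊆ V × p ∈ F × a ∈ F
  common-circuit {V = V} = common-circuit-within V (<-wellFounded _)

-- Binary matroids

xor-interchange : ∀ a b c d → (a xor b) xor (c xor d) ≡ (a xor c) xor (b xor d)
xor-interchange = CommutativeSemigroupProperties.interchange
  (CommutativeRing.+-commutativeSemigroup xor-∧-commutativeRing)

sum-⊕ : (S T : Subset n) (φ : Fin n → Bool) →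
        foldr _ _xor_ false (zipWith _∧_ (S ⊕ T) (tabulate φ)) ≡
        foldr _ _xor_ false (zipWith _∧_ S (tabulate φ)) xor foldr _ _xor_ false (zipWith _∧_ T (tabulate φ))
sum-⊕ []      []      φ = refl
sum-⊕ (s ∷ S) (t ∷ T) φ =
  trans (cong₂ _xor_ (∧-distribʳ-xor (φ zero) s t) (sum-⊕ S T (φ ∘ suc)))
        (xor-interchange (s ∧ φ zero) (t ∧ φ zero) _ _)

module BinaryCircuits (N : Matroid n) {r : ℕ} (A : Fin r → Fin n → Bool)
  (represents : ∀ C → (Circuit N C → MinimalDependent A C) × (MinimalDependent A C → Circuit N C)) where

  Cycle : Subset n → Set
  Cycle = ColumnSumZero A

  cycle-⊕ : ∀ S T → Cycle S → Cycle T → Cycle (S ⊕ T)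
  cycle-⊕ S T s t i = trans (sum-⊕ S T (A i)) (cong₂ _xor_ (s i) (t i))

  -- If `S` missed an element of `D`, it would be a dependent proper subset, against minimality.
  cycle-in-circuit : ∀ {D S} → Circuit N D → Cycle S → S ⊆ D → Nonempty S → D ⊆ S
  cycle-in-circuit {D} {S} d s S⊆D ne {x} x∈D with x ∈? S
  ... | yes x∈S = x∈S
  ... | no  x∉S = ⊥-elim (proj₂ (proj₁ (represents D) d) S ((λ {_} → S⊆D) , x , x∈D , x∉S)
                                (S , id , ne , s))

  circuit⇒cycle : ∀ {D} → Circuit N D → Cycle D
  circuit⇒cycle {D} d =
    let S , S⊆D , ne , s = proj₁ (proj₁ (represents D) d)
    in subst Cycle (⊆-antisym S⊆D (cycle-in-circuit d s S⊆D ne)) s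

-- Fibres of a homomorphism to a binary matroid

module Fibres (M : Matroid m) (N : Matroid n) (f : Fin m → Fin n)
  (connected : Connected M) {r : ℕ} (A : Fin r → Fin n → Bool)
  (represents : ∀ C → (Circuit N C → MinimalDependent A C) × (MinimalDependent A C → Circuit N C))
  (N-not-circuit : ¬ Circuit N ⊤) (f-hom : IsHom M N f) where

  open Circuits M
  module ᴺ = Circuits N
  open BinaryCircuits N A represents

  f-onto : StrictlySurjective _≡_ f
  f-onto y = let x , p = proj₁ f-hom y in x , p refl

  image-circuit : ∀ {C} → Circuit M C → Circuit N (image f C)
  image-circuit = proj₂ f-hom _

  -- The case `a ≡ b` is included, so each element of `U` lies on a circuit inside `U`.
  ConnectedOn : Subset m → Set
  ConnectedOn U = ∀ {a b} → a ∈ U → b ∈ U → ∃ λ C → Circuit M C × C ⊆ U × a ∈ C × b ∈ C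

  connectedOn-∪ : ∀ {U C u} → ConnectedOn U → Circuit M C → u ∈ U → u ∈ C → ConnectedOn (U ∪ C)
  connectedOn-∪ {U} {C} conn c u∈U u∈C a∈ b∈ with x∈p∪q⁻ U C a∈ | x∈p∪q⁻ U C b∈
  ... | inj₁ a∈U | inj₁ b∈U = let F , cF , F⊆U , a∈F , b∈F = conn a∈U b∈U
                              in F , cF , (λ z∈F → p⊆p∪q C (F⊆U z∈F)) , a∈F , b∈F
  ... | inj₂ a∈C | inj₂ b∈C = C , c , q⊆p∪q U C , a∈C , b∈C
  ... | inj₁ a∈U | inj₂ b∈C = let F , cF , F⊆U , a∈F , u∈F = conn a∈U u∈U
                              in common-circuit (p⊆p∪q C ∘ F⊆U) (q⊆p∪q U C) cF c a∈F u∈F u∈C b∈C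
  ... | inj₂ a∈C | inj₁ b∈U = let F , cF , F⊆U , u∈F , b∈F = conn u∈U b∈U
                              in common-circuit (q⊆p∪q U C) (p⊆p∪q C ∘ F⊆U) c cF a∈C u∈C u∈F b∈F

  -- The image of `F` is itself a circuit inside `D`, and circuits are incomparable.
  image-fills : ∀ {U D F} → Circuit N D → (∀ {a} → a ∈ U → f a ∈ D) →
                Circuit M F → F ⊆ U → D ⊆ image f F
  image-fills {D = D} {F} d fU⊆D cF F⊆U = ᴺ.circuit-⊆⇒⊇ (image-circuit cF) d fF⊆D
    where
    fF⊆D : image f F ⊆ D
    fF⊆D y∈ with x , x∈F , refl ← ∈-image⁻ f y∈ = fU⊆D (F⊆U x∈F)

  -- The ear is `C ∩ ∁ U`, and `minimal` forbids a circuit that meets and leaves `U` with a strictly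
  -- smaller part outside `U`. The goal is `fills`, which leaves room for only one circuit inside
  -- `U`.
  module Ear {U D C p u} (conn : ConnectedOn U) (d : Circuit N D) (fU⊆D : ∀ {a} → a ∈ U → f a ∈ D)
    (c : Circuit M C) (u∈U : u ∈ U) (u∈C : u ∈ C)
    (minimal : ∀ {C′ u′ z} → Circuit M C′ → u′ ∈ U → u′ ∈ C′ → z ∈ C′ → z ∉ U → ¬ (C′ ∩ ∁ U ⊂ C ∩ ∁ U))
    (p∈C : p ∈ C) (fp∉D : f p ∉ D) where

    p∉U : p ∉ U
    p∉U = fp∉D ∘ fU⊆D

    -- If `C′` meets `U`, omitting `t` would give it a smaller ear. If it does not, then `C′ ⊆ C`,
    -- and incomparability applies.
    contains-ear : ∀ {C′ q t} → Circuit M C′ → C′ ⊆ U ∪ C → q ∈ C′ → q ∉ U → t ∈ C → t ∉ U → t ∈ C′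
    contains-ear {C′} {q} {t} c′ C′⊆ q∈C′ q∉U t∈C t∉U with t ∈? C′ | any? (λ z → z ∈? U ×-dec z ∈? C′)
    ... | yes t∈C′ | _ = t∈C′
    ... | no  t∉C′ | yes (z , z∈U , z∈C′) =
      ⊥-elim (minimal c′ z∈U z∈C′ q∈C′ q∉U (sub , t , x∈p∩q⁺ (t∈C , x∉p⇒x∈∁p t∉U) , t∉))
      where
      sub : C′ ∩ ∁ U ⊆ C ∩ ∁ U
      sub x∈ with x∈C′ , x∈∁U ← x∈p∩q⁻ C′ (∁ U) x∈ with x∈p∪q⁻ U C (C′⊆ x∈C′)
      ... | inj₁ x∈U = contradiction x∈U (x∈∁p⇒x∉p x∈∁U)
      ... | inj₂ x∈C = x∈p∩q⁺ (x∈C , x∈∁U)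
      t∉ : t ∉ C′ ∩ ∁ U
      t∉ = t∉C′ ∘ proj₁ ∘ x∈p∩q⁻ C′ (∁ U)
    ... | no  t∉C′ | no disjoint = contradiction (circuit-⊆⇒⊇ c′ c C′⊆C t∈C) t∉C′
      where
      C′⊆C : C′ ⊆ C
      C′⊆C {z} z∈C′ with x∈p∪q⁻ U C (C′⊆ z∈C′)
      ... | inj₁ z∈U = contradiction (z , z∈U , z∈C′) disjoint
      ... | inj₂ z∈C = z∈C

    avoids-ear : ∀ {G} → Circuit M G → G ⊆ U ∪ C → p ∉ G → G ⊆ U
    avoids-ear g G⊆ p∉G {z} z∈G with z ∈? U
    ... | yes z∈U = z∈U
    ... | no  z∉U = contradiction (contains-ear g G⊆ z∈G z∉U p∈C p∉U) p∉G

    record Through (C′ : Subset m) : Set where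
      field
        circuit : Circuit M C′
        within  : C′ ⊆ U ∪ C
        p∈      : p ∈ C′
    open Through

    through : ∀ {a} → a ∈ U → ∃ λ C′ → Through C′ × a ∈ C′
    through a∈U =
      let F , cF , F⊆U , u∈F , a∈F = conn u∈U a∈U
          C′ , c′ , C′⊆ , p∈C′ , a∈C′ = common-circuit (q⊆p∪q U C) (p⊆p∪q C ∘ F⊆U) c cF p∈C u∈C u∈F a∈F
      in C′ , record { circuit = c′ ; within = C′⊆ ; p∈ = p∈C′ } , a∈C′

    -- Both circuits contain the whole ear, so their images can differ only at values taken on `U`.
    image∖image⊆D : ∀ {C₁ C₂ z} → Through C₁ → Through C₂ → z ∈ image f C₁ → z ∉ image f C₂ → z ∈ D
    image∖image⊆D t₁ t₂ z∈₁ z∉₂ with w , w∈C₁ , refl ← ∈-image⁻ f z∈₁ with w ∈? U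
    ... | yes w∈U = fU⊆D w∈U
    ... | no  w∉U with x∈p∪q⁻ U C (within t₁ w∈C₁)
    ...   | inj₁ w∈U = fU⊆D w∈U
    ...   | inj₂ w∈C = contradiction
              (∈-image⁺ f (contains-ear (circuit t₂) (within t₂) (p∈ t₂) p∉U w∈C w∉U)) z∉₂

    ⊕⊆D : ∀ {C₁ C₂} → Through C₁ → Through C₂ → image f C₁ ⊕ image f C₂ ⊆ D
    ⊕⊆D {C₁} {C₂} t₁ t₂ z∈ with ∈-⊕⁻ (image f C₁) (image f C₂) z∈
    ... | inj₁ (z∈₁ , z∉₂) = image∖image⊆D t₁ t₂ z∈₁ z∉₂
    ... | inj₂ (z∉₁ , z∈₂) = image∖image⊆D t₂ t₁ z∈₂ z∉₁

    -- The sum of the two images is a cycle inside the circuit `D`, hence empty or all of `D`.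
    agree-or-complement : ∀ {C₁ C₂} → Through C₁ → Through C₂ →
      Empty (image f C₁ ⊕ image f C₂) ⊎ D ⊆ image f C₁ ⊕ image f C₂
    agree-or-complement {C₁} {C₂} t₁ t₂ with nonempty? (image f C₁ ⊕ image f C₂)
    ... | no  em = inj₁ em
    ... | yes ne = inj₂ (cycle-in-circuit d
            (cycle-⊕ (image f C₁) (image f C₂) (circuit⇒cycle (image-circuit (circuit t₁))) (circuit⇒cycle (image-circuit (circuit t₂))))
            (⊕⊆D t₁ t₂) ne)

    missed : ∀ {C₁} → Through C₁ → ∃ λ e → e ∈ D × e ∉ image f C₁
    missed t₁ = ᴺ.circuit-∖-nonempty d (image-circuit (circuit t₁)) (∈-image⁺ f (p∈ t₁)) fp∉D

    -- Eliminating `p` from two distinct circuits leaves `G` inside `U`, whose image covers `D`. But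
    -- `G ⊆ C₁ ∪ C₂`, and the common image of `C₁` and `C₂` misses a point of `D`.
    agree⇒≡ : ∀ {C₁ C₂} → Through C₁ → Through C₂ → Empty (image f C₁ ⊕ image f C₂) → C₁ ≡ C₂
    agree⇒≡ {C₁} {C₂} t₁ t₂ em with ≡-dec Bool._≟_ C₁ C₂
    ... | yes eq = eq
    ... | no  C₁≢C₂
      with G , cG , G⊆ , p∉G ← eliminate (circuit t₁) (circuit t₂) C₁≢C₂ (p∈ t₁) (p∈ t₂)
      with e , e∈D , e∉₁ ← missed t₁
      with w , w∈G , refl ← ∈-image⁻ f (image-fills d fU⊆D cG (avoids-ear cG (∪-⊆ (within t₁) (within t₂) ∘ G⊆) p∉G) e∈D)
      with x∈p∪q⁻ C₁ C₂ (G⊆ w∈G)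
    ...   | inj₁ w∈C₁ = contradiction (∈-image⁺ f w∈C₁) e∉₁
    ...   | inj₂ w∈C₂ = contradiction (f w , ∈-⊕⁺ʳ e∉₁ (∈-image⁺ f w∈C₂)) em

    fills : ∀ {F} → Circuit M F → F ⊆ U → U ⊆ F
    fills {F} cF F⊆U {a} a∈U
      with C₁ , t₁ , a∈C₁ ← through a∈U
      with e , e∈D , e∉₁ ← missed t₁
      with b , b∈F , refl ← ∈-image⁻ f (image-fills d fU⊆D cF F⊆U e∈D)
      with C₂ , t₂ , b∈C₂ ← through (F⊆U b∈F)
      with C₃ , c₃ , C₃⊆ , b∉C₃ , p∈C₃ ← strong-elimination (circuit t₂) cF b∈C₂ b∈F (p∈ t₂) (p∉U ∘ F⊆U)
      with t₃ ← record { circuit = c₃ ; within = ∪-⊆ (within t₂) (p⊆p∪q C ∘ F⊆U) ∘ C₃⊆ ; p∈ = p∈C₃ }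
      -- The images of `C₁` and `C₂` differ at `f b`, so they are complementary on `D`. Three images
      -- cannot be pairwise complementary, and `C₂ ≢ C₃` because of `b`; hence `C₁ ≡ C₃`. Then
      -- `a ∈ C₂ ∪ F`, and complementarity at `f a` excludes `C₂`.
      with agree-or-complement t₁ t₂ | agree-or-complement t₁ t₃ | agree-or-complement t₂ t₃
    ... | inj₁ em | _ | _ = contradiction (f b , ∈-⊕⁺ʳ e∉₁ (∈-image⁺ f b∈C₂)) em
    ... | inj₂ _ | inj₂ _ | inj₁ em = contradiction (subst (b ∈_) (agree⇒≡ t₂ t₃ em) b∈C₂) b∉C₃
    ... | inj₂ _ | inj₂ D⊆₁₃ | inj₂ D⊆₂₃ =
      [ (λ (e∈₁ , _) → contradiction e∈₁ e∉₁)
      , (λ (_ , e∈₃) → contradiction (D⊆₂₃ e∈D) (∉-⊕ (∈-image⁺ f b∈C₂) e∈₃)) ]′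
      (∈-⊕⁻ (image f C₁) (image f C₃) (D⊆₁₃ e∈D))
    ... | inj₂ D⊆₁₂ | inj₁ em | _ =
      [ (λ a∈C₂ → contradiction (D⊆₁₂ (fU⊆D a∈U)) (∉-⊕ (∈-image⁺ f a∈C₁) (∈-image⁺ f a∈C₂)))
      , id ]′
      (x∈p∪q⁻ C₂ F (C₃⊆ (subst (a ∈_) (agree⇒≡ t₁ t₃ em) a∈C₁)))

  -- U grows by minimal ears until it is all of E(M).  Minimality of the ear is free:
  -- a smaller ear would already be refuted by the induction hypothesis.
  no-circuit-image : ∀ {U D F F′} → Acc _<_ ∣ ∁ U ∣ → ConnectedOn U →
    Circuit N D → (∀ {a} → a ∈ U → f a ∈ D) →
    Circuit M F → Circuit M F′ → F ⊆ U → F′ ⊆ U → F ≢ F′ → Absurd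
  no-circuit-image {U} {D} {F} {F′} (acc rec) conn d fU⊆D cF cF′ F⊆U F′⊆U F≢F′
    with any? (λ z → ¬? (z ∈? U))
  ... | no all = N-not-circuit (subst (Circuit N) (⊆-antisym (⊆-max D) ⊤⊆D) d)
    where
    ⊤⊆D : ⊤ ⊆ D
    ⊤⊆D {y} _ with x , refl ← f-onto y with x ∈? U
    ... | yes x∈U = fU⊆D x∈U
    ... | no  x∉U = contradiction (x , x∉U) all
  ... | yes (z , z∉U) =
    let u , u∈F = circuit-nonempty cF
        C , c , u∈C , z∈C = connected u z λ { refl → z∉U (F⊆U u∈F) }
    in ear (<-wellFounded _) c (F⊆U u∈F) u∈C z∈C z∉U
    where
    ear : ∀ {C u z} → Acc _<_ ∣ C ∩ ∁ U ∣ → Circuit M C → u ∈ U → u ∈ C → z ∈ C → z ∉ U → Absurd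
    ear {C} {u} {z} (acc recC) c u∈U u∈C z∈C z∉U with any? (λ p → p ∈? C ×-dec ¬? (f p ∈? D))
    ... | yes (p , p∈C , fp∉D) =
      F≢F′ (trans (⊆-antisym F⊆U (fills cF F⊆U)) (sym (⊆-antisym F′⊆U (fills cF′ F′⊆U))))
      where
      open Ear conn d fU⊆D c u∈U u∈C
        (λ c′ u′∈U u′∈C′ z′∈C′ z′∉U lt → ear (recC (p⊂q⇒∣p∣<∣q∣ lt)) c′ u′∈U u′∈C′ z′∈C′ z′∉U) p∈C fp∉D
    ... | no fC⊆D =
      no-circuit-image (rec (p⊂q⇒∣p∣<∣q∣ (p⊂q⇒∁p⊃∁q (p⊆p∪q C , z , q⊆p∪q U C z∈C , z∉U))))
        (connectedOn-∪ conn c u∈U u∈C) d fV⊆D cF cF′ (p⊆p∪q C ∘ F⊆U) (p⊆p∪q C ∘ F′⊆U) F≢F′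
      where
      fV⊆D : ∀ {a} → a ∈ U ∪ C → f a ∈ D
      fV⊆D {a} a∈ with x∈p∪q⁻ U C a∈ | f a ∈? D
      ... | _         | yes fa∈D = fa∈D
      ... | inj₁ a∈U  | no  _    = fU⊆D a∈U
      ... | inj₂ a∈C  | no  fa∉D = contradiction (a , a∈C , fa∉D) fC⊆D

  -- Induction on the size of `V` takes the place of choosing `C₁ ∪ C₂` minimal: a recursive call
  -- refutes the same configuration inside a smaller set.
  no-theta : ∀ {C₁ C₂ x y} (V : Subset m) → Acc _<_ ∣ V ∣ → f x ≡ f y →
             Circuit M C₁ → Circuit M C₂ → C₁ ⊆ V → C₂ ⊆ V →
             x ∈ C₁ → y ∈ C₁ → x ∈ C₂ → y ∉ C₂ → Absurd
  no-theta {C₁} {C₂} {x} {y} V (acc rec) fx≡fy c₁ c₂ C₁⊆V C₂⊆V x∈C₁ y∈C₁ x∈C₂ y∉C₂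
    with C₃ , c₃ , C₃⊆ , x∉C₃ , y∈C₃ ← strong-elimination c₁ c₂ x∈C₁ x∈C₂ y∈C₁ y∉C₂
    = no-circuit-image (<-wellFounded _)
        (connectedOn-∪ (λ a∈ b∈ → C₁ , c₁ , (λ {_} → id) , a∈ , b∈) c₂ x∈C₁ x∈C₂) (image-circuit c₁)
        f∪⊆B₁ c₁ c₂ (p⊆p∪q C₂) (q⊆p∪q C₁ C₂) (λ { refl → y∉C₂ y∈C₁ })
    where
    C₃⊆V : C₃ ⊆ V
    C₃⊆V = ∪-⊆ C₁⊆V C₂⊆V ∘ C₃⊆

    -- Otherwise `C₁` and `C₃`, with `x` and `y` exchanged, repeat the configuration inside `V - t`.
    C₂∖C₁⊆C₃ : ∀ {t} → t ∈ C₂ → t ∉ C₁ → t ∈ C₃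
    C₂∖C₁⊆C₃ {t} t∈C₂ t∉C₁ with t ∈? C₃
    ... | yes t∈C₃ = t∈C₃
    ... | no  t∉C₃ = ⊥-elim (no-theta (V - t) (rec (x∈p⇒∣p-x∣<∣p∣ (C₂⊆V t∈C₂))) (sym fx≡fy) c₁ c₃
            (⊆-minus C₁⊆V t∉C₁) (⊆-minus C₃⊆V t∉C₃) y∈C₁ x∈C₁ y∈C₃ x∉C₃)

    -- Otherwise `C₂` and `C₃` both miss `t` and share `h`, so some circuit through `x` and `y`
    -- avoids `t` and repeats the configuration with `C₂`.
    C₁∖C₂⊆C₃ : ∀ {t} → t ∈ C₁ → t ∉ C₂ → t ∈ C₃
    C₁∖C₂⊆C₃ {t} t∈C₁ t∉C₂ with t ∈? C₃
    ... | yes t∈C₃ = t∈C₃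
    ... | no  t∉C₃ =
      let h , h∈C₂ , h∉C₁ = circuit-∖-nonempty c₂ c₁ y∈C₁ y∉C₂
          C , c , C⊆ , x∈C , y∈C = common-circuit (⊆-minus C₂⊆V t∉C₂) (⊆-minus C₃⊆V t∉C₃) c₂ c₃
            x∈C₂ h∈C₂ (C₂∖C₁⊆C₃ h∈C₂ h∉C₁) y∈C₃
      in ⊥-elim (no-theta (V - t) (rec (x∈p⇒∣p-x∣<∣p∣ (C₁⊆V t∈C₁))) fx≡fy c c₂
           C⊆ (⊆-minus C₂⊆V t∉C₂) x∈C y∈C x∈C₂ y∉C₂)

    B₁ B₂ B₃ S : Subset n
    B₁ = image f C₁
    B₂ = image f C₂
    B₃ = image f C₃
    S  = B₁ ⊕ B₂ ⊕ B₃

    S-cycle : Cycle S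
    S-cycle = cycle-⊕ B₁ (B₂ ⊕ B₃) (circuit⇒cycle (image-circuit c₁))
                (cycle-⊕ B₂ B₃ (circuit⇒cycle (image-circuit c₂)) (circuit⇒cycle (image-circuit c₃)))

    -- The point `f x` lies in all three images, in `B₃` by way of `y`.
    S-nonempty : Nonempty S
    S-nonempty = f x , ∈-⊕⁺ˡ (∈-image⁺ f x∈C₁)
      (∉-⊕ (∈-image⁺ f x∈C₂) (subst (_∈ B₃) (sym fx≡fy) (∈-image⁺ f y∈C₃)))

    B₂⊆B₁∪B₃ : ∀ {z} → z ∈ B₂ → z ∉ B₃ → z ∈ B₁
    B₂⊆B₁∪B₃ z∈B₂ z∉B₃ with t , t∈C₂ , refl ← ∈-image⁻ f z∈B₂ with t ∈? C₁
    ... | yes t∈C₁ = ∈-image⁺ f t∈C₁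
    ... | no  t∉C₁ = contradiction (∈-image⁺ f (C₂∖C₁⊆C₃ t∈C₂ t∉C₁)) z∉B₃

    B₁⊆B₂∪B₃ : ∀ {z} → z ∈ B₁ → z ∉ B₃ → z ∈ B₂
    B₁⊆B₂∪B₃ z∈B₁ z∉B₃ with t , t∈C₁ , refl ← ∈-image⁻ f z∈B₁ with t ∈? C₂
    ... | yes t∈C₂ = ∈-image⁺ f t∈C₂
    ... | no  t∉C₂ = contradiction (∈-image⁺ f (C₁∖C₂⊆C₃ t∈C₁ t∉C₂)) z∉B₃

    B₃⊆B₁∪B₂ : ∀ {z} → z ∈ B₃ → z ∉ B₂ → z ∈ B₁
    B₃⊆B₁∪B₂ z∈B₃ z∉B₂ with t , t∈C₃ , refl ← ∈-image⁻ f z∈B₃ with x∈p∪q⁻ C₁ C₂ (C₃⊆ t∈C₃)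
    ... | inj₁ t∈C₁ = ∈-image⁺ f t∈C₁
    ... | inj₂ t∈C₂ = contradiction (∈-image⁺ f t∈C₂) z∉B₂

    -- Every element of B₁ ∪ B₂ ∪ B₃ lies in at least two of the Bᵢ, so S = B₁ ∩ B₂ ∩ B₃.
    S⊆B₁ : S ⊆ B₁
    S⊆B₁ z∈S with ∈-⊕⁻ B₁ (B₂ ⊕ B₃) z∈S
    ... | inj₁ (z∈B₁ , _) = z∈B₁
    ... | inj₂ (_ , z∈) with ∈-⊕⁻ B₂ B₃ z∈
    ...   | inj₁ (z∈B₂ , z∉B₃) = B₂⊆B₁∪B₃ z∈B₂ z∉B₃
    ...   | inj₂ (z∉B₂ , z∈B₃) = B₃⊆B₁∪B₂ z∈B₃ z∉B₂

    S⊆B₂ : S ⊆ B₂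
    S⊆B₂ {z} z∈S with z ∈? B₂ | z ∈? B₃
    ... | yes z∈B₂ | _        = z∈B₂
    ... | no  _    | no  z∉B₃ = B₁⊆B₂∪B₃ (S⊆B₁ z∈S) z∉B₃
    ... | no  z∉B₂ | yes z∈B₃ = contradiction z∈S (∉-⊕ (S⊆B₁ z∈S) (∈-⊕⁺ʳ z∉B₂ z∈B₃))

    -- A nonempty cycle inside the circuit `B₂` is all of it, so `B₂ ⊆ S ⊆ B₁`.
    f∪⊆B₁ : ∀ {a} → a ∈ C₁ ∪ C₂ → f a ∈ B₁
    f∪⊆B₁ a∈ with x∈p∪q⁻ C₁ C₂ a∈
    ... | inj₁ a∈C₁ = ∈-image⁺ f a∈C₁
    ... | inj₂ a∈C₂ = S⊆B₁ (cycle-in-circuit (image-circuit c₂) S-cycle S⊆B₂ S-nonempty (∈-image⁺ f a∈C₂))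

  fibre-closed : ∀ {C x y} → Circuit M C → x ∈ C → f x ≡ f y → y ∈ C
  fibre-closed {C} {x} {y} c x∈C fx≡fy with y ∈? C
  ... | yes y∈C = y∈C
  ... | no  y∉C =
    let C₁ , c₁ , x∈C₁ , y∈C₁ = connected x y λ { refl → y∉C x∈C }
    in ⊥-elim (no-theta (C₁ ∪ C) (<-wellFounded _) fx≡fy c₁ c (p⊆p∪q C) (q⊆p∪q C₁ C) x∈C₁ y∈C₁ x∈C y∉C)

-- Pullbacks and series extensions

PullbackCircuit : Matroid n → (Fin m → Fin n) → Subset m → Set
PullbackCircuit H g C = ∃ λ D → Circuit H D × C ≡ preimage g D

preimage-⊆⁻ : {g : Fin m → Fin n} → StrictlySurjective _≡_ g → {C D : Subset n} →
              preimage g C ⊆ preimage g D → C ⊆ D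
preimage-⊆⁻ {g = g} onto C⊆D {y} y∈C with x , refl ← onto y = ∈-preimage⁻ g (C⊆D (∈-preimage⁺ g y∈C))

preimage-⊂⁻ : {g : Fin m → Fin n} → StrictlySurjective _≡_ g → {C D : Subset n} →
              preimage g C ⊂ preimage g D → C ⊂ D
preimage-⊂⁻ {g = g} onto (C⊆D , x , x∈D , x∉C) =
  preimage-⊆⁻ onto C⊆D , g x , ∈-preimage⁻ g x∈D , x∉C ∘ ∈-preimage⁺ g

pullback : (H : Matroid n) (g : Fin m → Fin n) → StrictlySurjective _≡_ g → Matroid m
pullback H g onto = record
  { Circuit      = PullbackCircuit H g
  ; empty-not    = λ (D , d , ⊥≡) →
      let y , y∈D = circuit-nonempty d
          x , gx≡y = onto y
      in ∉⊥ (subst (x ∈_) (sym ⊥≡) (∈-preimage⁺ g (subst (_∈ D) (sym gx≡y) y∈D)))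
  ; incomparable = λ { (C , c , refl) (D , d , refl) C⊂D → incomparable H c d (preimage-⊂⁻ onto C⊂D) }
  ; elimination  = λ { {e = e} (C , c , refl) (D , d , refl) C≢D e∈C e∈D →
      let F , cF , F⊆ , ge∉F = eliminate c d (C≢D ∘ cong (preimage g)) (∈-preimage⁻ g e∈C) (∈-preimage⁻ g e∈D)
      in preimage g F , (F , cF , refl)
       , ⊆-minus (preimage-⊆-∪ F⊆) (ge∉F ∘ ∈-preimage⁻ g) }
  }
  where
  open Circuits H
  preimage-⊆-∪ : ∀ {C D F} → F ⊆ C ∪ D → preimage g F ⊆ preimage g C ∪ preimage g D
  preimage-⊆-∪ {C} {D} F⊆ z∈ with x∈p∪q⁻ C D (F⊆ (∈-preimage⁻ g z∈))
  ... | inj₁ gz∈C = x∈p∪q⁺ (inj₁ (∈-preimage⁺ g gz∈C))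
  ... | inj₂ gz∈D = x∈p∪q⁺ (inj₂ (∈-preimage⁺ g gz∈D))

-- A series extension always puts its new element at `zero`, so `S` lists the elements in its own
-- order; the bijection `α` matches them with the domain of `f`, over `g`.
record SubdivisionAlong (H : Matroid n) (f : Fin m → Fin n) : Set₁ where
  field
    {size}      : ℕ
    S           : Matroid size
    subdivides  : Subdivision H S
    g           : Fin size → Fin n
    g-onto      : StrictlySurjective _≡_ g
    circuits    : ∀ C → (Circuit S C → PullbackCircuit H g C) × (PullbackCircuit H g C → Circuit S C)
    α           : Fin m → Fin size
    α-injective : Injective _≡_ _≡_ α
    α-onto      : StrictlySurjective _≡_ α
    factors     : ∀ x → g (α x) ≡ f x

preimage-id : (D : Subset n) → preimage id D ≡ D
preimage-id = tabulate∘lookup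

unsubdivided : (H : Matroid n) {f : Fin m → Fin n} → StrictlySurjective _≡_ f → Injective _≡_ _≡_ f →
               SubdivisionAlong H f
unsubdivided H {f} onto inj = record
  { S = H ; subdivides = base ; g = id ; g-onto = λ y → y , refl
  ; circuits = λ C → (λ c → C , c , sym (preimage-id C))
                   , (λ { (D , d , refl) → subst (Circuit H) (sym (preimage-id D)) d })
  ; α = f ; α-injective = inj ; α-onto = onto ; factors = λ _ → refl }

-- With `x` deleted, `y` still represents its fibre. Restoring `x` as `zero`, in series with the
-- copy `e′` of `y`, makes circuits preimages along `g′`: the new bit of `preimage g′ D` is the bit
-- at `e′`.
extend : (H : Matroid n) (f : Fin (suc m) → Fin n) {x y : Fin (suc m)} → x ≢ y → f x ≡ f y →
         SubdivisionAlong H (f ∘ punchIn x) → SubdivisionAlong H f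
extend {n = n} {m = m} H f {x} {y} x≢y fx≡fy T = record
  { S = pullback H g′ g′-onto
  ; subdivides = step e′ T.subdivides λ b C → series⁻ , series⁺
  ; g = g′ ; g-onto = g′-onto
  ; circuits = λ C → id , id
  ; α = α′ ; α-injective = α′-injective ; α-onto = α′-onto ; factors = factors′ }
  where
  module T = SubdivisionAlong T

  g′ : Fin (suc T.size) → Fin n
  g′ zero    = f x
  g′ (suc z) = T.g z

  g′-onto : StrictlySurjective _≡_ g′
  g′-onto y = let z , eq = T.g-onto y in suc z , eq

  e′ : Fin T.size
  e′ = T.α (punchOut x≢y)

  ge′≡fx : T.g e′ ≡ f x
  ge′≡fx = trans (T.factors (punchOut x≢y)) (trans (cong f (punchIn-punchOut x≢y)) (sym fx≡fy))

  lookup-e′ : (D : Subset n) → lookup (preimage T.g D) e′ ≡ lookup D (f x)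
  lookup-e′ D = trans (lookup∘tabulate _ e′) (cong (lookup D) ge′≡fx)

  series⁻ : ∀ {b C} → PullbackCircuit H g′ (b ∷ C) → Circuit T.S C × b ≡ lookup C e′
  series⁻ (D , d , refl) = proj₂ (T.circuits _) (D , d , refl) , sym (lookup-e′ D)

  series⁺ : ∀ {b C} → Circuit T.S C × b ≡ lookup C e′ → PullbackCircuit H g′ (b ∷ C)
  series⁺ {C = C} (c , refl) with D , d , refl ← proj₁ (T.circuits C) c =
    D , d , cong (_∷ preimage T.g D) (lookup-e′ D)

  α′ : Fin (suc m) → Fin (suc T.size)
  α′ w with x ≟ w
  ... | yes _   = zero
  ... | no  x≢w = suc (T.α (punchOut x≢w))

  α′-injective : Injective _≡_ _≡_ α′
  α′-injective {v} {w} eq with x ≟ v | x ≟ w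
  α′-injective eq | yes refl | yes refl = refl
  α′-injective eq | no x≢v   | no x≢w   = punchOut-injective x≢v x≢w (T.α-injective (suc-injective eq))

  α′-x : α′ x ≡ zero
  α′-x with x ≟ x
  ... | yes _   = refl
  ... | no  x≢x = contradiction refl x≢x

  α′-punchIn : ∀ z → α′ (punchIn x z) ≡ suc (T.α z)
  α′-punchIn z with x ≟ punchIn x z
  ... | yes eq  = contradiction (sym eq) (punchInᵢ≢i x z)
  ... | no  x≢w = cong (suc ∘ T.α) (trans (punchOut-cong x refl) (punchOut-punchIn x))

  α′-onto : StrictlySurjective _≡_ α′
  α′-onto zero    = x , α′-x
  α′-onto (suc z) with w , refl ← T.α-onto z = punchIn x w , α′-punchIn w

  factors′ : ∀ w → g′ (α′ w) ≡ f w
  factors′ w with x ≟ w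
  ... | yes refl = refl
  ... | no  x≢w  = trans (T.factors (punchOut x≢w)) (cong f (punchIn-punchOut x≢w))

subdivide : (H : Matroid n) (f : Fin m → Fin n) → StrictlySurjective _≡_ f → SubdivisionAlong H f
subdivide {m = zero}  H f onto = unsubdivided H onto λ { {()} }
subdivide {m = suc m} H f onto with any? (λ x → any? λ y → ¬? (x ≟ y) ×-dec (f x ≟ f y))
... | yes (x , y , x≢y , fx≡fy) = extend H f x≢y fx≡fy (subdivide H (f ∘ punchIn x) onto′)
  where
  onto′ : StrictlySurjective _≡_ (f ∘ punchIn x)
  onto′ z with w , refl ← onto z with x ≟ w
  -- The value lost with `x` is still attained at `y`.
  ... | yes refl = punchOut x≢y , trans (cong f (punchIn-punchOut x≢y)) (sym fx≡fy)
  ... | no  x≢w  = punchOut x≢w , cong f (punchIn-punchOut x≢w)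
... | no ¬collision = unsubdivided H onto inj
  where
  inj : Injective _≡_ _≡_ f
  inj {x} {y} fx≡fy with x ≟ y
  ... | yes x≡y = x≡y
  ... | no  x≢y = contradiction (x , y , x≢y , fx≡fy) ¬collision

image-preimage : {f : Fin m → Fin n} → StrictlySurjective _≡_ f → (D : Subset n) → image f (preimage f D) ≡ D
image-preimage {f = f} onto D = ⊆-antisym fwd bwd
  where
  fwd : image f (preimage f D) ⊆ D
  fwd y∈ with x , x∈ , refl ← ∈-image⁻ f {preimage f D} y∈ = ∈-preimage⁻ f x∈
  bwd : D ⊆ image f (preimage f D)
  bwd {y} y∈D with x , refl ← onto y = ∈-image⁺ f (∈-preimage⁺ f y∈D)

image-id : (D : Subset n) → image id D ≡ D
image-id D = trans (cong (image id) (sym (preimage-id D))) (image-preimage (λ y → y , refl) D)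

-- Identifying the elements of each fibre

module Quotient (M : Matroid m) (f : Fin m → Fin n) (onto : StrictlySurjective _≡_ f)
  (fibre-closed : ∀ {C x y} → Circuit M C → x ∈ C → f x ≡ f y → y ∈ C) where

  open Circuits M

  preimage-image : ∀ {C} → Circuit M C → preimage f (image f C) ≡ C
  preimage-image {C} c = ⊆-antisym fwd (∈-preimage⁺ f ∘ ∈-image⁺ f)
    where
    fwd : preimage f (image f C) ⊆ C
    fwd x∈ with z , z∈C , fz≡fx ← ∈-image⁻ f (∈-preimage⁻ f x∈) = fibre-closed c z∈C fz≡fx

  -- With circuits defined through preimages, one half of the homeomorphism condition is immediate.
  -- Circuits of `M` are unions of fibres, so `image f` and `preimage f` match them with the
  -- circuits here, and elimination in `M` carries over.
  quotient : Matroid n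
  quotient = record
    { Circuit      = Circuit M ∘ preimage f
    ; empty-not    = λ c → let x , x∈ = circuit-nonempty c in ∉⊥ (∈-preimage⁻ f x∈)
    ; incomparable = λ c d (C⊆D , y , y∈D , y∉C) →
        let x , fx≡y = onto y in
        incomparable M c d ((λ x∈C → ∈-preimage⁺ f (C⊆D (∈-preimage⁻ f x∈C)))
                           , x , ∈-preimage⁺ f (subst (_∈ _) (sym fx≡y) y∈D)
                           , λ x∈C → y∉C (subst (_∈ _) fx≡y (∈-preimage⁻ f x∈C)))
    ; elimination  = elim
    }
    where
    elim : ∀ {C D e} → Circuit M (preimage f C) → Circuit M (preimage f D) → C ≢ D → e ∈ C → e ∈ D →
           ∃ λ F → Circuit M (preimage f F) × F ⊆ ((C ∪ D) - e)
    elim {C} {D} {e} c d C≢D e∈C e∈D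
      with x , refl ← onto e
      with F , cF , F⊆ , x∉F ← eliminate c d
             (λ eq → C≢D (trans (sym (image-preimage onto C)) (trans (cong (image f) eq) (image-preimage onto D))))
             (∈-preimage⁺ f e∈C) (∈-preimage⁺ f e∈D)
      = image f F , subst (Circuit M) (sym (preimage-image cF)) cF , ⊆-minus fF⊆ fx∉fF
      where
      fF⊆ : image f F ⊆ C ∪ D
      fF⊆ y∈ with z , z∈F , refl ← ∈-image⁻ f y∈ with x∈p∪q⁻ (preimage f C) (preimage f D) (F⊆ z∈F)
      ... | inj₁ z∈C = x∈p∪q⁺ (inj₁ (∈-preimage⁻ f z∈C))
      ... | inj₂ z∈D = x∈p∪q⁺ (inj₂ (∈-preimage⁻ f z∈D))
      fx∉fF : f x ∉ image f F
      fx∉fF fx∈ with z , z∈F , fz≡fx ← ∈-image⁻ f fx∈ = x∉F (fibre-closed cF z∈F fz≡fx)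

  quotient-homeo : IsHomeo M quotient f
  quotient-homeo =
    ( strictlySurjective⇒surjective onto
    , λ C c → subst (Circuit M) (sym (preimage-image c)) c ) , λ D d → d

  subdivision-iso : (T : SubdivisionAlong quotient f) → Isomorphic M (SubdivisionAlong.S T)
  subdivision-iso T = α , α-injective , strictlySurjective⇒surjective α-onto , λ C → to , from
    where
    open SubdivisionAlong T

    -- Since `C` is a union of fibres of `f` and `f` is `g` after the bijection `α`, the set
    -- `image α C` is a union of fibres of `g`.
    image-α : ∀ C → Circuit M C → image α C ≡ preimage g (image f C)
    image-α C c = ⊆-antisym fwd bwd
      where
      fwd : image α C ⊆ preimage g (image f C)
      fwd z∈ with x , x∈C , refl ← ∈-image⁻ α {C} z∈ =
        ∈-preimage⁺ g (subst (_∈ image f C) (sym (factors x)) (∈-image⁺ f x∈C))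
      bwd : preimage g (image f C) ⊆ image α C
      bwd {z} z∈ with x , refl ← α-onto z with w , w∈C , fw≡ ← ∈-image⁻ f (∈-preimage⁻ g z∈) =
        ∈-image⁺ α (fibre-closed c w∈C (trans fw≡ (factors x)))

    to : ∀ {C} → Circuit M C → Circuit S (image α C)
    to {C} c = proj₂ (circuits _) (image f C , subst (Circuit M) (sym (preimage-image c)) c , image-α C c)

    from : ∀ {C} → Circuit S (image α C) → Circuit M C
    from {C} c with D , d , eq ← proj₁ (circuits _) c = subst (Circuit M) (⊆-antisym fwd bwd) d
      where
      fwd : preimage f D ⊆ C
      fwd {x} x∈ with w , w∈C , αw≡αx ← ∈-image⁻ α (subst (α x ∈_) (sym eq)
                        (∈-preimage⁺ g (subst (_∈ D) (sym (factors x)) (∈-preimage⁻ f x∈))))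
        = subst (_∈ C) (α-injective αw≡αx) w∈C
      bwd : C ⊆ preimage f D
      bwd {x} x∈C = ∈-preimage⁺ f (subst (_∈ D) (factors x)
                      (∈-preimage⁻ g (subst (α x ∈_) eq (∈-image⁺ α x∈C))))

theorem3 : ∀ {m n} (M : Matroid m) (N : Matroid n) (f : Fin m → Fin n) →
    Connected M → Binary N → ¬ Circuit N ⊤ → IsHom M N f →
    Σ ℕ λ k → Σ (Matroid k) λ H → Σ (Fin m → Fin k) λ g → Σ (Fin k → Fin n) λ h →
    IsHomeo M H g × IsCircuitInjection H N h × (∀ x → f x ≡ h (g x)) ×
    (Σ ℕ λ j → Σ (Matroid j) λ S → Subdivision H S × Isomorphic M S)
theorem3 {n = n} M N f connected (r , A , represents) N-not-circuit f-hom =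
  -- As `f` is onto, `H` can live on the ground set of `N`, so the injection is the identity.
  n , quotient , f , id , quotient-homeo , id-injection , (λ _ → refl) ,
  size , S , subdivides , subdivision-iso T
  where
  open Fibres M N f connected A represents N-not-circuit f-hom
  open Quotient M f f-onto fibre-closed

  T : SubdivisionAlong quotient f
  T = subdivide quotient f f-onto
  open SubdivisionAlong T using (size; S; subdivides)

  id-injection : IsCircuitInjection quotient N id
  id-injection =
    ( strictlySurjective⇒surjective (λ y → y , refl)
    -- A circuit `D` of `quotient` is the image under `f` of the circuit `preimage f D` of `M`,
    -- hence a circuit of `N`.
    , λ D d → subst (Circuit N) (trans (image-preimage f-onto D) (sym (image-id D))) (image-circuit d) ) , id
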